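{- Let $\nu=\nu_1\nu_2\cdots\nu_{k-1}$ be a word of distinct integers in $[k]$, and let $r$ be the unique element of $[k]\setminus\{\nu_1,\ldots,\nu_{k-1}\}$. Let $\alpha=(\nu;\,r\to\nu_i)$, where $i\in[k-1]$ is such that $r>\nu_i$. Then $\alpha\sim\alpha^{rc}$.
   Context: $[n]=\{1,\dots,n\}$, and $\mathcal{S}_n$ is the set of permutations $\pi=\pi_1\pi_2\cdots\pi_n$ of $[n]$ in one-line notation. The permutation $\hat\pi$: for $\pi\in\mathcal{S}_n$, $\hat\pi\in\mathcal{S}_n$ is the permutation whose cycle form is obtained from the word $\pi_1\cdots\pi_n$ by inserting a left parenthesis before each left-to-right maximum (an entry larger than all entries to its left) and a right parenthesis immediately before the next left-to-right maximum, or at the end of the word. A cycle $(c_1,c_2,\dots,c_s)$ means $c_1\mapsto c_2\mapsto\cdots\mapsto c_s\mapsto c_1$. Example: if $\pi=2537164$ then $\hat\pi=(2)(53)(7164)$. Arrow patterns: an arrow pattern of size $k$ is a pair $(\nu;H)$ where $\nu=\nu_1\cdots\nu_m$ is a word of distinct positive integers, $H$ is a collection of arrows $b_i\to c_i$, and the set of all integers appearing in $\nu$ or $H$ is $[k]$. A permutation $\pi\in\mathcal{S}_n$ contains $(\nu;H)$ if there are a set $X=\{x_1<x_2<\cdots<x_k\}\subseteq[n]$ and indices $t_1<\cdots<t_m$ such that $\pi_{t_1}\pi_{t_2}\cdots\pi_{t_m}=x_{\nu_1}x_{\nu_2}\cdots x_{\nu_m}$ and $\hat\pi(x_{b_i})=x_{c_i}$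 for every arrow $b_i\to c_i$ in $H$. Otherwise $\pi$ avoids $(\nu;H)$. $\mathcal{S}_n(\nu;H)$ is the set of permutations in $\mathcal{S}_n$ avoiding $(\nu;H)$. Two arrow patterns $\alpha,\beta$ are arrow-Wilf-equivalent, written $\alpha\sim\beta$, if $|\mathcal{S}_n(\alpha)|=|\mathcal{S}_n(\beta)|$ for all $n\ge 1$. Operations on an arrow pattern $\alpha=(\nu;H)$ of size $k$, with $\nu=\nu_1\cdots\nu_m$ and $H=\{b_i\to c_i:1\le i\le t\}$: the reverse is $\alpha^r=(\nu_m\nu_{m-1}\cdots\nu_1;\{c_i\to b_i:1\le i\le t\})$; the complement is $\alpha^c=((k+1-\nu_1)\cdots(k+1-\nu_m);\{k+1-b_i\to k+1-c_i:1\le i\le t\})$; the reverse-complement is $\alpha^{rc}=(\alpha^r)^c=(\alpha^c)^r$. -}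

module Defs where

open import Data.Fin using (Fin; zero; suc; opposite; _<_; #_)
open import Data.Fin.Properties using (_≟_; _<?_; any?; opposite-involutive; injective⇒≤)
open import Data.Fin.Permutation using (Permutation′; _⟨$⟩ʳ_) renaming (_≈_ to _≈ₚ_)
open import Data.List using (List; []; _∷_; [_]; _∷ʳ_; map; tabulate)
open import Data.List.Membership.DecPropositional using () renaming (_∈?_ to ∈-dec)
open import Data.List.Relation.Unary.All using (All)
open import Data.List.Relation.Unary.Any as Any using (Any; here)
open import Data.List.Relation.Unary.Any.Properties using () renaming (map⁺ to Any-map⁺)
open import Data.Nat using (ℕ; suc; _≤_)
open import Data.Nat.Properties using (1+n≰n)
open import Data.Product using (Σ; ∃; _×_; _,_; proj₁; proj₂; swap)
open import Data.Sum as Sum using (_⊎_; inj₁; inj₂)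
open import Function using (_∘_; Inverse; Injective)
open import Level using (0ℓ)
open import Relation.Binary using (Setoid; _Preserves_⟶_)
open import Relation.Binary.PropositionalEquality
  using (_≡_; _≢_; refl; sym; trans; cong)
open import Relation.Nullary using (¬_; yes; no; contradiction)

-- Throughout, [n] is represented by Fin n, so that i ∈ [n] corresponds to the
-- element with toℕ equal to i - 1, and n + 1 - i corresponds to opposite i.
-- A permutation π of Fin n has one-line notation π ⟨$⟩ʳ 0, π ⟨$⟩ʳ 1, ….

oneLine : ∀ {n} → Permutation′ n → List (Fin n)
oneLine π = tabulate (π ⟨$⟩ʳ_)

-- In splitFrom max c ys, max is the largest entry read so far, c is the cycle
-- currently open, and ys is the unread part of the word.

splitFrom : ∀ {n} → Fin n → List (Fin n) → List (Fin n) → List (List (Fin n))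
splitFrom max c []       = [ c ]
splitFrom max c (y ∷ ys) with max <? y
... | yes _ = c ∷ splitFrom y [ y ] ys
... | no  _ = splitFrom max (c ∷ʳ y) ys

cycleForm : ∀ {n} → List (Fin n) → List (List (Fin n))
cycleForm []       = []
cycleForm (y ∷ ys) = splitFrom y [ y ] ys

private
  example : List (Fin 7)
  example = # 1 ∷ # 4 ∷ # 2 ∷ # 6 ∷ # 0 ∷ # 5 ∷ # 3 ∷ []

-- The word 2537164 splits as (2)(53)(7164).
_ : cycleForm example
  ≡ (# 1 ∷ []) ∷ (# 4 ∷ # 2 ∷ []) ∷ (# 6 ∷ # 0 ∷ # 5 ∷ # 3 ∷ []) ∷ []
_ = refl

-- nextFrom c₁ c cs a, where c ∷ cs is a tail of a cycle with first entry c₁, is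
-- the entry following a in c ∷ cs, and c₁ if a is the last entry. (The value when
-- a does not occur in c ∷ cs is irrelevant.)

nextFrom : ∀ {n} → Fin n → Fin n → List (Fin n) → Fin n → Fin n
nextFrom c₁ c []       a = c₁
nextFrom c₁ c (d ∷ ds) a with a ≟ c
... | yes _ = d
... | no  _ = nextFrom c₁ d ds a

applyCycle : ∀ {n} → List (Fin n) → Fin n → Fin n
applyCycle []       a = a
applyCycle (c ∷ cs) a = nextFrom c c cs a

-- The action of a family of disjoint cycles: a is moved by the cycle containing it.

applyCycles : ∀ {n} → List (List (Fin n)) → Fin n → Fin n
applyCycles []       a = a
applyCycles (c ∷ cs) a with ∈-dec _≟_ a c
... | yes _ = applyCycle c a
... | no  _ = applyCycles cs a

-- (2)(53)(7164) has one-line notation 6257341.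
_ : tabulate (applyCycles (cycleForm example))
  ≡ # 5 ∷ # 1 ∷ # 4 ∷ # 6 ∷ # 2 ∷ # 3 ∷ # 0 ∷ []
_ = refl

hat : ∀ {n} → Permutation′ n → Fin n → Fin n
hat π = applyCycles (cycleForm (oneLine π))

-- The pair (b , c) in arrows is the arrow b → c; the order and multiplicity of
-- the entries of this list play no role.

record ArrowPattern (k : ℕ) : Set where
  field
    len      : ℕ
    word     : Fin len → Fin k
    distinct : Injective _≡_ _≡_ word
    arrows   : List (Fin k × Fin k)
    covers   : ∀ j → (∃ λ i → word i ≡ j) ⊎ Any (λ a → proj₁ a ≡ j ⊎ proj₂ a ≡ j) arrows

open ArrowPattern

record Contains {k n : ℕ} (α : ArrowPattern k) (π : Permutation′ n) : Set where
  field
    x            : Fin k → Fin n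
    x-increasing : x Preserves _<_ ⟶ _<_
    t            : Fin (len α) → Fin n
    t-increasing : t Preserves _<_ ⟶ _<_
    occurrence   : ∀ j → π ⟨$⟩ʳ t j ≡ x (word α j)
    arrowsHold   : All (λ a → hat π (x (proj₁ a)) ≡ x (proj₂ a)) (arrows α)

Avoids : ∀ {k n} → ArrowPattern k → Permutation′ n → Set
Avoids α π = ¬ Contains α π

-- 𝒮ₙ(α). Two elements are equal when they are the same permutation pointwise;
-- neither the chosen inverse nor the proof of avoidance matters.

Avoiders : ∀ {k} → ArrowPattern k → ℕ → Setoid 0ℓ 0ℓ
Avoiders α n = record
  { Carrier       = Σ (Permutation′ n) (Avoids α)
  ; _≈_           = λ p q → proj₁ p ≈ₚ proj₁ q
  ; isEquivalence = record
    { refl  = λ _ → refl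
    ; sym   = λ e i → sym (e i)
    ; trans = λ e f i → trans (e i) (f i)
    }
  }

-- Equality of the cardinalities |𝒮ₙ(α)| and |𝒮ₙ(β)| is the existence of a
-- bijection between the two setoids.

infix 4 _∼_

_∼_ : ∀ {k l} → ArrowPattern k → ArrowPattern l → Set
α ∼ β = ∀ n → 1 ≤ n → Inverse (Avoiders α n) (Avoiders β n)

opposite-injective : ∀ {n} → Injective _≡_ _≡_ (opposite {n})
opposite-injective {_} {i} {j} e =
  trans (sym (opposite-involutive i)) (trans (cong opposite e) (opposite-involutive j))

opposite-flip : ∀ {n} {i j : Fin n} → i ≡ opposite j → opposite i ≡ j
opposite-flip {j = j} e = trans (cong opposite e) (opposite-involutive j)

reverse : ∀ {k} → ArrowPattern k → ArrowPattern k
reverse α = record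
  { len      = len α
  ; word     = word α ∘ opposite
  ; distinct = opposite-injective ∘ distinct α
  ; arrows   = map swap (arrows α)
  ; covers   = λ j → Sum.map
      (λ (i , e) → opposite i , trans (cong (word α) (opposite-involutive i)) e)
      (Any-map⁺ ∘ Any.map Sum.swap)
      (covers α j)
  }

complement : ∀ {k} → ArrowPattern k → ArrowPattern k
complement α = record
  { len      = len α
  ; word     = opposite ∘ word α
  ; distinct = distinct α ∘ opposite-injective
  ; arrows   = map (λ a → opposite (proj₁ a) , opposite (proj₂ a)) (arrows α)
  ; covers   = λ j → Sum.map
      (λ (i , e) → i , opposite-flip e)
      (Any-map⁺ ∘ Any.map (Sum.map opposite-flip opposite-flip))
      (covers α (opposite j))
  }

reverseComplement : ∀ {k} → ArrowPattern k → ArrowPattern k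
reverseComplement α = complement (reverse α)

missing-unique : ∀ {m} (ν : Fin m → Fin (suc m)) → Injective _≡_ _≡_ ν →
                 (r : Fin (suc m)) → (∀ j → ν j ≢ r) →
                 ∀ j → (∃ λ i → ν i ≡ j) ⊎ r ≡ j
missing-unique {m} ν ν-inj r r∉ν j with any? (λ i → ν i ≟ j) | r ≟ j
... | yes p | _     = inj₁ p
... | no  _ | yes e = inj₂ e
... | no ¬p | no r≢j = contradiction (injective⇒≤ f-inj) 1+n≰n
  where
  f : Fin (suc (suc m)) → Fin (suc m)
  f zero          = r
  f (suc zero)    = j
  f (suc (suc i)) = ν i

  f-inj : Injective _≡_ _≡_ f
  f-inj {zero}        {zero}        _ = refl
  f-inj {zero}        {suc zero}    e = contradiction e r≢j
  f-inj {zero}        {suc (suc i)} e = contradiction (sym e) (r∉ν i)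
  f-inj {suc zero}    {zero}        e = contradiction (sym e) r≢j
  f-inj {suc zero}    {suc zero}    _ = refl
  f-inj {suc zero}    {suc (suc i)} e = contradiction (i , sym e) ¬p
  f-inj {suc (suc i)} {zero}        e = contradiction e (r∉ν i)
  f-inj {suc (suc i)} {suc zero}    e = contradiction (i , e) ¬p
  f-inj {suc (suc i)} {suc (suc l)} e = cong (λ a → suc (suc a)) (ν-inj e)

-- The arrow pattern (ν; r → νᵢ) of size k = m + 1, for r the element of [k] missing from ν.

missingArrow : ∀ {m} (ν : Fin m → Fin (suc m)) → Injective _≡_ _≡_ ν →
               (r : Fin (suc m)) → (∀ j → ν j ≢ r) → Fin m → ArrowPattern (suc m)
missingArrow {m} ν ν-inj r r∉ν i = record
  { len      = m
  ; word     = ν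
  ; distinct = ν-inj
  ; arrows   = [ (r , ν i) ]
  ; covers   = λ j → Sum.map₂ (λ e → here (inj₁ e)) (missing-unique ν ν-inj r r∉ν j)
  }

{-# OPTIONS --safe #-}
module Submission where

-- An arrow b → c of π̂ with c < b cannot close a cycle, because the cycles begin
-- with their maxima; so it holds exactly when b immediately precedes c in the word
-- of π. This condition is preserved when π and the arrow are both
-- reverse-complemented. Hence, for a pattern all of whose arrows descend, reverse-
-- complementation of permutations maps avoiders of α to avoiders of α^rc.

open import Defs
open ArrowPattern
open import Data.Nat using (ℕ; suc; s<s)
import Data.Nat as ℕ
import Data.Nat.Properties as ℕ
open import Data.Fin using (Fin; zero; suc; toℕ; opposite; _<_; _≤_)
open import Data.Fin.Properties
  using (_≟_; _<?_; toℕ<n; opposite-prop; opposite-involutive; suc-injective)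
open import Data.Fin.Permutation using (Permutation′; _⟨$⟩ʳ_; _∘ₚ_) renaming (_≈_ to _≈ₚ_; reverse to reverseₚ)
open import Data.List using (List; []; _∷_; _∷ʳ_; _++_; tabulate)
open import Data.List.Properties using (++-assoc; ++-identityʳ; tabulate-cong)
open import Data.List.Membership.Propositional using (_∈_; _∉_)
open import Data.List.Membership.DecPropositional using () renaming (_∈?_ to ∈-dec)
open import Data.List.Relation.Unary.All as All using (All; []; _∷_)
import Data.List.Relation.Unary.All.Properties as All
open import Data.List.Relation.Unary.Any using (here; there)
open import Data.Product using (∃₂; _×_; _,_; proj₁; proj₂)
open import Data.Sum using (_⊎_; inj₁; inj₂)
open import Function using (Injective; module Injection; _∘_)
open import Function.Properties.Inverse using (↔⇒↣)
open import Relation.Binary.PropositionalEquality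
  using (_≡_; _≢_; refl; sym; trans; cong; subst; subst₂; module ≡-Reasoning)
open import Relation.Nullary using (yes; no; contradiction)

private variable
  A : Set
  k n : ℕ

-- Only the first occurrence of a counts, as in nextFrom and applyCycles; this spares
-- carrying distinctness of the entries through the cycle form.
data Follows {A : Set} (a b : A) : List A → Set where
  here  : ∀ {ys} → Follows a b (a ∷ b ∷ ys)
  there : ∀ {y ys} → y ≢ a → Follows a b ys → Follows a b (y ∷ ys)

module _ {a b : A} where

  follows-++⁺ˡ : ∀ {xs} ys → Follows a b xs → Follows a b (xs ++ ys)
  follows-++⁺ˡ ys here        = here
  follows-++⁺ˡ ys (there p f) = there p (follows-++⁺ˡ ys f)

  follows-++⁺ʳ : ∀ xs {ys} → a ∉ xs → Follows a b ys → Follows a b (xs ++ ys)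
  follows-++⁺ʳ []       a∉ f = f
  follows-++⁺ʳ (x ∷ xs) a∉ f = there (a∉ ∘ here ∘ sym) (follows-++⁺ʳ xs (a∉ ∘ there) f)

  follows-++⁻ʳ : ∀ xs {ys} → a ∉ xs → Follows a b (xs ++ ys) → Follows a b ys
  follows-++⁻ʳ []                   a∉ f           = f
  follows-++⁻ʳ (_ ∷ [])     {_ ∷ _} a∉ here        = contradiction (here refl) a∉
  follows-++⁻ʳ (_ ∷ _ ∷ _)          a∉ here        = contradiction (here refl) a∉
  follows-++⁻ʳ (_ ∷ xs)             a∉ (there _ f) = follows-++⁻ʳ xs (a∉ ∘ there) f

  -- The first `a` lies in `xs`, so its successor does too, unless that `a` is the last entry of
  -- `xs`. The second alternative is the seam at which a new cycle opens.
  follows-++∷⁻ : ∀ xs {y ys} → a ∈ xs → Follows a b (xs ++ y ∷ ys) → Follows a b xs ⊎ b ≡ y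
  follows-++∷⁻ (x ∷ [])      _         here        = inj₂ refl
  follows-++∷⁻ (x ∷ x′ ∷ xs) _         here        = inj₁ here
  follows-++∷⁻ (x ∷ xs)      (here p)  (there q f) = contradiction (sym p) q
  follows-++∷⁻ (x ∷ xs)      (there p) (there q f) with follows-++∷⁻ xs p f
  ... | inj₁ g = inj₁ (there q g)
  ... | inj₂ e = inj₂ e

  follows⇒∈ : ∀ {xs} → Follows a b xs → a ∈ xs
  follows⇒∈ here        = here refl
  follows⇒∈ (there _ f) = there (follows⇒∈ f)

  follows-tabulate⁻ : (f : Fin n → A) → Follows a b (tabulate f) →
                      ∃₂ λ s s′ → toℕ s′ ≡ suc (toℕ s) × f s ≡ a × f s′ ≡ b
  follows-tabulate⁻ {suc (suc n)} f here = zero , suc zero , refl , refl , refl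
  follows-tabulate⁻ {suc n} f (there _ p) with follows-tabulate⁻ (f ∘ suc) p
  ... | s , s′ , e , p , q = suc s , suc s′ , cong suc e , p , q

  -- Injectivity makes position `s` the first occurrence of `a`, the only one that `Follows` counts.
  follows-tabulate⁺ : (f : Fin n → A) → Injective _≡_ _≡_ f → ∀ s s′ → toℕ s′ ≡ suc (toℕ s) →
                      f s ≡ a → f s′ ≡ b → Follows a b (tabulate f)
  follows-tabulate⁺ f inj zero    (suc zero) e refl refl = here
  follows-tabulate⁺ f inj (suc s) (suc s′)   e p    q    =
    there (λ r → contradiction (inj (trans r (sym p))) λ ())
      (follows-tabulate⁺ (f ∘ suc) (suc-injective ∘ inj) s s′ (ℕ.suc-injective e) p q)

module _ {a b : Fin n} where

  -- The value `c₁` arises from wrapping around at the end of the cycle; `b ≢ c₁` excludes this,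
  -- which leaves an adjacent pair.
  nextFrom⇒follows : ∀ c₁ c cs → a ∈ c ∷ cs → b ≢ c₁ → nextFrom c₁ c cs a ≡ b → Follows a b (c ∷ cs)
  nextFrom⇒follows c₁ c []       a∈ b≢ e = contradiction (sym e) b≢
  nextFrom⇒follows c₁ c (d ∷ ds) a∈ b≢ e with a ≟ c
  nextFrom⇒follows c₁ c (d ∷ ds) a∈        b≢ refl | yes refl = here
  nextFrom⇒follows c₁ c (d ∷ ds) (here p)  b≢ e    | no a≢c = contradiction p a≢c
  nextFrom⇒follows c₁ c (d ∷ ds) (there p) b≢ e    | no a≢c =
    there (a≢c ∘ sym) (nextFrom⇒follows c₁ d ds p b≢ e)

  follows⇒nextFrom : ∀ c₁ c cs → Follows a b (c ∷ cs) → nextFrom c₁ c cs a ≡ b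
  follows⇒nextFrom c₁ c []       (there _ ())
  follows⇒nextFrom c₁ c (d ∷ ds) f with a ≟ c
  follows⇒nextFrom c₁ c (d ∷ ds) here        | yes _   = refl
  follows⇒nextFrom c₁ c (d ∷ ds) (there p _) | yes refl = contradiction refl p
  follows⇒nextFrom c₁ c (d ∷ ds) here        | no a≢c = contradiction refl a≢c
  follows⇒nextFrom c₁ c (d ∷ ds) (there _ f) | no _   = follows⇒nextFrom c₁ d ds f

  module _ (b<a : b < a) where

    -- Since `b < a ≤ m`, an arrow from `a` to `b` inside a cycle with maximum `m` does not return
    -- to `m`.
    ∈-bounded⇒b≢ : ∀ {m xs} → All (_≤ m) xs → a ∈ xs → b ≢ m
    ∈-bounded⇒b≢ xs≤m a∈ refl = ℕ.<-irrefl refl (ℕ.<-≤-trans b<a (All.lookup xs≤m a∈))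

    -- Induction on the unread word. The bound is the invariant that the open cycle `m ∷ cs` starts
    -- with its maximum. Reading `y` into the open cycle only reassociates the word
    -- `m ∷ cs ++ y ∷ ys`.
    splitFrom⇒follows : ∀ m cs ys → All (_≤ m) (m ∷ cs) →
                        applyCycles (splitFrom m (m ∷ cs) ys) a ≡ b → Follows a b (m ∷ cs ++ ys)
    splitFrom⇒follows m cs [] cs≤m e with ∈-dec _≟_ a (m ∷ cs)
    ... | yes a∈ = subst (Follows a b) (sym (++-identityʳ (m ∷ cs)))
                     (nextFrom⇒follows m m cs a∈ (∈-bounded⇒b≢ cs≤m a∈) e)
    -- `applyCycles` fixes an entry found in no cycle, so `e` would give `a ≡ b`.
    ... | no  _  = contradiction b<a (ℕ.<-irrefl (cong toℕ (sym e)))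
    splitFrom⇒follows m cs (y ∷ ys) cs≤m e with m <? y
    ... | no m≮y = subst (Follows a b) (++-assoc (m ∷ cs) _ ys)
                     (splitFrom⇒follows m (cs ∷ʳ y) ys (All.∷ʳ⁺ cs≤m (ℕ.≮⇒≥ m≮y)) e)
    ... | yes _ with ∈-dec _≟_ a (m ∷ cs)
    ...   | yes a∈ = follows-++⁺ˡ (y ∷ ys) (nextFrom⇒follows m m cs a∈ (∈-bounded⇒b≢ cs≤m a∈) e)
    ...   | no  a∉ = follows-++⁺ʳ (m ∷ cs) a∉ (splitFrom⇒follows y [] ys (ℕ.≤-refl ∷ []) e)

    follows⇒splitFrom : ∀ m cs ys → All (_≤ m) (m ∷ cs) →
                        Follows a b (m ∷ cs ++ ys) → applyCycles (splitFrom m (m ∷ cs) ys) a ≡ b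
    follows⇒splitFrom m cs [] cs≤m f
      with f′ ← subst (Follows a b) (++-identityʳ (m ∷ cs)) f
      with ∈-dec _≟_ a (m ∷ cs)
    ... | yes _  = follows⇒nextFrom m m cs f′
    ... | no  a∉ = contradiction (follows⇒∈ f′) a∉
    follows⇒splitFrom m cs (y ∷ ys) cs≤m f with m <? y
    ... | no m≮y = follows⇒splitFrom m (cs ∷ʳ y) ys (All.∷ʳ⁺ cs≤m (ℕ.≮⇒≥ m≮y))
                     (subst (Follows a b) (sym (++-assoc (m ∷ cs) _ ys)) f)
    ... | yes m<y with ∈-dec _≟_ a (m ∷ cs)
    ...   | no  a∉ = follows⇒splitFrom y [] ys (ℕ.≤-refl ∷ []) (follows-++⁻ʳ (m ∷ cs) a∉ f)
    ...   | yes a∈ with follows-++∷⁻ (m ∷ cs) a∈ f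
    ...     | inj₁ g    = follows⇒nextFrom m m cs g
    -- A descending pair cannot straddle two cycles: here `b` would be the new left-to-right
    -- maximum, and `m < b < a ≤ m`.
    ...     | inj₂ refl = contradiction (ℕ.<-≤-trans m<y (ℕ.≤-trans (ℕ.<⇒≤ b<a) (All.lookup cs≤m a∈)))
                            (ℕ.<-irrefl refl)

    cycleForm⇒follows : ∀ xs → applyCycles (cycleForm xs) a ≡ b → Follows a b xs
    cycleForm⇒follows []       e = contradiction b<a (ℕ.<-irrefl (cong toℕ (sym e)))
    cycleForm⇒follows (y ∷ ys) e = splitFrom⇒follows y [] ys (ℕ.≤-refl ∷ []) e

    follows⇒cycleForm : ∀ xs → Follows a b xs → applyCycles (cycleForm xs) a ≡ b
    follows⇒cycleForm (y ∷ ys) f = follows⇒splitFrom y [] ys (ℕ.≤-refl ∷ []) f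

opposite-mono-< : {i j : Fin n} → i < j → opposite j < opposite i
opposite-mono-< {i = i} {j} i<j =
  subst₂ ℕ._<_ (sym (opposite-prop j)) (sym (opposite-prop i)) (ℕ.∸-monoʳ-< (s<s i<j) (toℕ<n j))

opposite-suc-≡ : (s s′ : Fin n) → toℕ s′ ≡ suc (toℕ s) → toℕ (opposite s) ≡ suc (toℕ (opposite s′))
opposite-suc-≡ {n} s s′ e = begin
  toℕ (opposite s)         ≡⟨ opposite-prop s ⟩
  n ℕ.∸ suc (toℕ s)        ≡⟨ cong (n ℕ.∸_) e ⟨
  -- The left side is definitionally `suc n ∸ suc (toℕ s′)`; the bound `toℕ s′ < n` keeps the
  -- subtraction from truncating when the `suc` is pulled out.
  n ℕ.∸ toℕ s′             ≡⟨ ℕ.+-∸-assoc 1 (toℕ<n s′) ⟩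
  suc (n ℕ.∸ suc (toℕ s′)) ≡⟨ cong suc (opposite-prop s′) ⟨
  suc (toℕ (opposite s′))  ∎
  where open ≡-Reasoning

-- `_∘ₚ_` composes from left to right: the first `reverseₚ` reverses positions, the last complements
-- values.
rc : Permutation′ n → Permutation′ n
rc π = reverseₚ ∘ₚ π ∘ₚ reverseₚ

rc-cong : {π ρ : Permutation′ n} → π ≈ₚ ρ → rc π ≈ₚ rc ρ
rc-cong e i = cong opposite (e (opposite i))

rc-involutive : (π : Permutation′ n) → rc (rc π) ≈ₚ π
rc-involutive π i = trans (opposite-involutive _) (cong (π ⟨$⟩ʳ_) (opposite-involutive i))

hat-cong : {π ρ : Permutation′ n} → π ≈ₚ ρ → ∀ a → hat π a ≡ hat ρ a
hat-cong e a = cong (λ xs → applyCycles (cycleForm xs) a) (tabulate-cong e)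

-- The arrow is turned into adjacent positions `s`, `s′`. Reversal exchanges their order and
-- complementation restores the descent, so the adjacent pair read in `rc π` is again an arrow.
hat-rc : (π : Permutation′ n) {a b : Fin n} → b < a → hat π a ≡ b → hat (rc π) (opposite b) ≡ opposite a
hat-rc π {a} {b} b<a e
  with s , s′ , next , πs≡a , πs′≡b ← follows-tabulate⁻ (π ⟨$⟩ʳ_) (cycleForm⇒follows b<a (oneLine π) e)
  = follows⇒cycleForm (opposite-mono-< b<a) (oneLine (rc π))
      (follows-tabulate⁺ (rc π ⟨$⟩ʳ_) (Injection.injective (↔⇒↣ (rc π)))
        (opposite s′) (opposite s) (opposite-suc-≡ s s′ next) (rc-opposite πs′≡b) (rc-opposite πs≡a))
  where
  rc-opposite : ∀ {i c} → π ⟨$⟩ʳ i ≡ c → rc π ⟨$⟩ʳ opposite i ≡ opposite c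
  rc-opposite e = cong opposite (trans (cong (π ⟨$⟩ʳ_) (opposite-involutive _)) e)

Descending : ArrowPattern k → Set
Descending α = All (λ a → proj₂ a < proj₁ a) (arrows α)

-- Reversal swaps the ends of an arrow and complementation swaps their order back. This allows
-- `contains-rc` to be applied a second time.
descending-rc : (α : ArrowPattern k) → Descending α → Descending (reverseComplement α)
descending-rc α d = All.map⁺ (All.map⁺ (All.map opposite-mono-< d))

contains-rc : (α : ArrowPattern k) (π : Permutation′ n) → Descending α →
              Contains α π → Contains (reverseComplement α) (rc π)
contains-rc α π d c = record
  -- Conjugating by `opposite` reverses the order twice, so `x` and `t` stay increasing.
  { x            = opposite ∘ x ∘ opposite
  ; x-increasing = opposite-mono-< ∘ x-increasing ∘ opposite-mono-<
  ; t            = opposite ∘ t ∘ opposite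
  ; t-increasing = opposite-mono-< ∘ t-increasing ∘ opposite-mono-<
  ; occurrence   = λ j → cong opposite (begin
      π ⟨$⟩ʳ opposite (opposite (t (opposite j)))     ≡⟨ cong (π ⟨$⟩ʳ_) (opposite-involutive _) ⟩
      π ⟨$⟩ʳ t (opposite j)                           ≡⟨ occurrence (opposite j) ⟩
      x (word α (opposite j))                         ≡⟨ cong x (opposite-involutive _) ⟨
      x (opposite (opposite (word α (opposite j))))   ∎)
  ; arrowsHold   = All.map⁺ (All.map⁺ (All.zipWith
      (λ {a} (b<a , e) → subst₂ (λ u v → hat (rc π) (opposite (x u)) ≡ opposite (x v))
        (sym (opposite-involutive (proj₂ a))) (sym (opposite-involutive (proj₁ a)))
        -- As `x` is increasing, a descending arrow of the pattern is realised by a descending arrow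
        -- of `hat π`.
        (hat-rc π (x-increasing b<a) e))
      (d , arrowsHold)))
  }
  where
  open Contains c
  open ≡-Reasoning

-- The double reverse-complement restores patterns and permutations only up to pointwise equality,
-- so the occurrence `x`, `t` is kept and its equations are transported.
contains-rc-rc⁻ : (α : ArrowPattern k) {π ρ : Permutation′ n} → π ≈ₚ ρ →
                  Contains (reverseComplement (reverseComplement α)) π → Contains α ρ
contains-rc-rc⁻ α {π} {ρ} π≈ρ c = record
  { x            = x
  ; x-increasing = x-increasing
  ; t            = t
  ; t-increasing = t-increasing
  ; occurrence   = λ j → begin
      ρ ⟨$⟩ʳ t j                                                ≡⟨ π≈ρ (t j) ⟨
      π ⟨$⟩ʳ t j                                                ≡⟨ occurrence j ⟩
      x (opposite (opposite (word α (opposite (opposite j)))))  ≡⟨ cong x (opposite-involutive _) ⟩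
      x (word α (opposite (opposite j)))                        ≡⟨ cong (x ∘ word α) (opposite-involutive j) ⟩
      x (word α j)                                              ∎
  ; arrowsHold   = All.map
      (λ {a} e → trans (sym (hat-cong {π = π} {ρ} π≈ρ (x (proj₁ a))))
        (subst₂ (λ u v → hat π (x u) ≡ x v)
          (opposite-involutive (proj₁ a)) (opposite-involutive (proj₂ a)) e))
      -- Each `reverseComplement` maps over the arrows twice, once to swap and once to complement.
      (All.map⁻ (All.map⁻ (All.map⁻ (All.map⁻ arrowsHold))))
  }
  where
  open Contains c
  open ≡-Reasoning

-- The forward direction, applied to the reverse-complemented pattern, followed by cancelling the
-- two involutions.
contains-rc⁻ : (α : ArrowPattern k) (π : Permutation′ n) → Descending α →
               Contains (reverseComplement α) (rc π) → Contains α π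
contains-rc⁻ α π d c = contains-rc-rc⁻ α {rc (rc π)} {π} (rc-involutive π)
  (contains-rc (reverseComplement α) (rc π) (descending-rc α d) c)

contains-resp-≈ : (α : ArrowPattern k) {π ρ : Permutation′ n} → π ≈ₚ ρ → Contains α π → Contains α ρ
contains-resp-≈ α {π} {ρ} π≈ρ c = record
  { x            = x
  ; x-increasing = x-increasing
  ; t            = t
  ; t-increasing = t-increasing
  ; occurrence   = λ j → trans (sym (π≈ρ (t j))) (occurrence j)
  ; arrowsHold   = All.map (trans (sym (hat-cong {π = π} {ρ} π≈ρ _))) arrowsHold
  }
  where open Contains c

descending⇒∼rc : (α : ArrowPattern k) → Descending α → α ∼ reverseComplement α
descending⇒∼rc α d n _ = record
  { to        = λ (π , avoids) → rc π , avoids ∘ contains-rc⁻ α π d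
  ; from      = λ (π , avoids) → rc π , λ c → avoids
      (contains-resp-≈ (reverseComplement α) {rc (rc π)} {π} (rc-involutive π) (contains-rc α (rc π) d c))
  ; to-cong   = λ {p} {q} → rc-cong {π = proj₁ p} {proj₁ q}
  ; from-cong = λ {p} {q} → rc-cong {π = proj₁ p} {proj₁ q}
  -- Both directions act by `rc`, so one statement serves for both inverse laws.
  ; inverse   = (λ {p} {q} → rc-adjoint (proj₁ p) (proj₁ q)) , (λ {p} {q} → rc-adjoint (proj₁ p) (proj₁ q))
  }
  where
  rc-adjoint : (π ρ : Permutation′ n) → ρ ≈ₚ rc π → rc ρ ≈ₚ π
  rc-adjoint π ρ e i = trans (rc-cong {π = ρ} {rc π} e i) (rc-involutive π i)

proposition2p4 : (m : ℕ) (ν : Fin m → Fin (suc m)) (ν-distinct : Injective _≡_ _≡_ ν)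
    (r : Fin (suc m)) (r-missing : ∀ j → ν j ≢ r)
    (i : Fin m) → ν i < r →
    missingArrow ν ν-distinct r r-missing i ∼ reverseComplement (missingArrow ν ν-distinct r r-missing i)
proposition2p4 m ν ν-distinct r r-missing i νi<r =
  descending⇒∼rc (missingArrow ν ν-distinct r r-missing i) (νi<r ∷ [])
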